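{- Let $G$ be the cubic graph constructed below. Then $\rho(G)=12$, $\omega_{\mathrm w}(G)=14$, and $\omega(G)=16$.
   Context: An \emph{even factor} of a graph is a spanning subgraph in which every vertex has even degree; a component is \emph{odd} if it has an odd number of vertices. The \emph{weak oddness} $\omega_{\mathrm w}(G)$ of a cubic graph is the least number of odd components in an even factor; the \emph{oddness} $\omega(G)$ of a bridgeless cubic graph is the minimum number of odd circuits in a $2$-factor; the \emph{resistance} $\rho(G)$ is the minimum number of vertices whose deletion leaves a graph with a proper $3$-edge-colouring. A \emph{$2$-pole} $(K,s,t)$ is a graph $K$ with two distinct vertices $s,t$ of degree one (terminals); the edges at them are terminal edges. Joining terminal edges of two disjoint $2$-poles means identifying the two terminal vertices and suppressing the resulting degree-$2$ vertex. Construction: Let $P$ be the $2$-pole obtained from the Petersen graph by subdividing one edge $uv$ with a new vertex $w$ and then splitting off $w$ (delete $w$ and attach a new degree-one terminal vertex to each of the two dangling edges). The $2$-pole $H$: take two copies $(P_1,s_1,t_1)$, $(P_2,s_2,t_2)$ of $P$, identify $s_1$ with $s_2$ and $t_1$ with $t_2$, and attach a new terminal edge (to a new degree-one vertex) at each of the two identified vertices; these two new degree-one vertices are the terminals of $H$. The $2$-pole $H_2$: take two copies of $H$ and join a terminal edge of the first to a terminal edge of the second; the two remaining terminals are the terminals of $H_2$. The graph $G$: take $K_4$ on $u_0,u_1,u_2,u_3$ and delete all edges incident with $u_0$; then for each $i\in\{1,2,3\}$ take a new copy of $H_2$ and identify one of its terminals with $u_0$ and the other with $u_i$. -}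

module Defs where

open import Data.Nat using (ℕ; zero; suc; _+_; _≡ᵇ_; _%_; _≤_)
open import Data.Nat.Divisibility using (_∣_)
open import Data.Bool using (Bool; true; false; _∧_; _∨_; if_then_else_)
open import Data.Fin using (Fin; toℕ)
import Data.Fin as F
open import Data.Fin.Subset using (Subset; _∈_; _∉_; ∣_∣)
open import Data.List using (List; []; _∷_; _++_; map; length; lookup)
import Data.Vec
open import Data.Sum using (_⊎_)
open import Data.Product using (_×_; _,_; proj₁; proj₂; Σ; ∃; ∃-syntax)
open import Relation.Binary.PropositionalEquality using (_≡_; _≢_)
open import Relation.Binary.Construct.Closure.ReflexiveTransitive using (Star)

-- Finite (multi)graphs given by a vertex count and an edge list.
-- Vertices are Fin order; edge i joins the vertices with numbers
-- proj₁ (lookup edges i) and proj₂ (lookup edges i).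

record Graph : Set where
  constructor mkGraph
  field
    order : ℕ
    edges : List (ℕ × ℕ)

open Graph public

V : Graph → Set
V G = Fin (order G)

E : Graph → Set
E G = Fin (length (edges G))

ends : (G : Graph) → E G → ℕ × ℕ
ends G e = lookup (edges G) e

incident : (G : Graph) → V G → E G → Bool
incident G v e = (toℕ v ≡ᵇ proj₁ (ends G e)) ∨ (toℕ v ≡ᵇ proj₂ (ends G e))

countF : {n : ℕ} → (Fin n → Bool) → ℕ
countF {zero}  p = 0
countF {suc n} p = (if p F.zero then 1 else 0) + countF (λ i → p (F.suc i))

-- a spanning subgraph is given by its edge set
EdgeSet : Graph → Set
EdgeSet G = Subset (length (edges G))

inS : {m : ℕ} → Subset m → Fin m → Bool
inS S e = Data.Vec.lookup S e

deg : (G : Graph) → EdgeSet G → V G → ℕ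
deg G S v = countF (λ e → inS S e ∧ incident G v e)

Adj : (G : Graph) → EdgeSet G → V G → V G → Set
Adj G S x y = (Σ (E G) λ e → e ∈ S × ends G e ≡ (toℕ x , toℕ y))
            ⊎ (Σ (E G) λ e → e ∈ S × ends G e ≡ (toℕ y , toℕ x))

Reach : (G : Graph) → EdgeSet G → V G → V G → Set
Reach G S = Star (Adj G S)

odd? : ℕ → Bool
odd? n = n % 2 ≡ᵇ 1

IsComponentLabelling : (G : Graph) → EdgeSet G → (V G → V G) → Set
IsComponentLabelling G S c =
  (x y : V G) → (c x ≡ c y → Reach G S x y) × (Reach G S x y → c x ≡ c y)

OddComponents : (G : Graph) → EdgeSet G → ℕ → Set
OddComponents G S k =
  Σ (V G → V G) λ c → IsComponentLabelling G S c ×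
    (k ≡ countF (λ (l : V G) → odd? (countF (λ v → toℕ (c v) ≡ᵇ toℕ l))))

EvenFactor : (G : Graph) → EdgeSet G → Set
EvenFactor G S = (v : V G) → 2 ∣ deg G S v

-- 2-factor: spanning subgraph with every degree 2 (its components are
-- circuits, odd circuits = odd components)
TwoFactor : (G : Graph) → EdgeSet G → Set
TwoFactor G S = (v : V G) → deg G S v ≡ 2

WeakOddness : Graph → ℕ → Set
WeakOddness G w =
  (∃[ S ] (EvenFactor G S × OddComponents G S w)) ×
  ((S : EdgeSet G) (k : ℕ) → EvenFactor G S → OddComponents G S k → w ≤ k)

Oddness : Graph → ℕ → Set
Oddness G w =
  (∃[ S ] (TwoFactor G S × OddComponents G S w)) ×
  ((S : EdgeSet G) (k : ℕ) → TwoFactor G S → OddComponents G S k → w ≤ k)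

Survives : (G : Graph) → Subset (order G) → E G → Set
Survives G D e = (v : V G) → incident G v e ≡ true → v ∉ D

Colourable-Minus : (G : Graph) → Subset (order G) → Set
Colourable-Minus G D =
  Σ (E G → Fin 3) λ col → (e f : E G) → e ≢ f → Survives G D e → Survives G D f →
    (∃[ v ] (incident G v e ≡ true × incident G v f ≡ true)) → col e ≢ col f

Resistance : Graph → ℕ → Set
Resistance G r =
  (∃[ D ] (∣ D ∣ ≡ r × Colourable-Minus G D)) ×
  ((D : Subset (order G)) → Colourable-Minus G D → r ≤ ∣ D ∣)

shiftE : ℕ → List (ℕ × ℕ) → List (ℕ × ℕ)
shiftE k = map (λ p → (k + proj₁ p , k + proj₂ p))

-- A 2-pole with internal vertices 0 .. size-1 (all of degree 3 once the
-- terminal edges are counted), internal edges, and the internal vertices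
-- sEnd, tEnd to which the terminal edges at s and t are attached
-- (terminal vertices themselves are not stored).
record TwoPole : Set where
  constructor mkPole
  field
    size  : ℕ
    inner : List (ℕ × ℕ)
    sEnd  : ℕ
    tEnd  : ℕ

open TwoPole public

-- Petersen graph: outer 5-cycle 0..4, spokes i–i+5, inner pentagram.
petersenEdges : List (ℕ × ℕ)
petersenEdges =
  (0 , 1) ∷ (1 , 2) ∷ (2 , 3) ∷ (3 , 4) ∷ (4 , 0) ∷
  (0 , 5) ∷ (1 , 6) ∷ (2 , 7) ∷ (3 , 8) ∷ (4 , 9) ∷
  (5 , 7) ∷ (7 , 9) ∷ (9 , 6) ∷ (6 , 8) ∷ (8 , 5) ∷ []

-- P: subdivide uv = 0–1 by w and split off w: the edge uv disappears and
-- terminal edges hang at u = 0 and v = 1.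
P : TwoPole
P = mkPole 10 (drop1 petersenEdges) 0 1
  where drop1 : List (ℕ × ℕ) → List (ℕ × ℕ)
        drop1 []       = []
        drop1 (_ ∷ xs) = xs

-- H: copies P₁ (vertices 0..9), P₂ (10..19); s₁=s₂ becomes vertex 20,
-- t₁=t₂ becomes vertex 21; terminal edges of H attached at 20 and 21.
H : TwoPole
H = mkPole 22
  (inner P ++ shiftE 10 (inner P) ++
   (sEnd P , 20) ∷ (10 + sEnd P , 20) ∷ (tEnd P , 21) ∷ (10 + tEnd P , 21) ∷ [])
  20 21

-- H₂: copies H (0..21), H' (22..43); the terminal edge at t of the first
-- and the terminal edge at s of the second are joined into one edge.
H₂ : TwoPole
H₂ = mkPole 44
  (inner H ++ shiftE 22 (inner H) ++ (tEnd H , 22 + sEnd H) ∷ [])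
  (sEnd H) (22 + tEnd H)

-- G: u₀,u₁,u₂,u₃ = 0,1,2,3 with the triangle u₁u₂u₃; the i-th copy of H₂
-- (i = 1,2,3) occupies vertices 4+44(i-1) .. 4+44i-1, its terminal s is
-- identified with u₀ and its terminal t with uᵢ.
copyAt : ℕ → ℕ → List (ℕ × ℕ)
copyAt off ui =
  shiftE off (inner H₂) ++ (0 , off + sEnd H₂) ∷ (ui , off + tEnd H₂) ∷ []

Gedges : List (ℕ × ℕ)
Gedges = (1 , 2) ∷ (1 , 3) ∷ (2 , 3) ∷ [] ++
         copyAt 4 1 ++ copyAt 48 2 ++ copyAt 92 3

G : Graph
G = mkGraph 136 Gedges

{-# OPTIONS --safe #-}
module Submission where

-- Each of the twelve copies of P in G costs something. Deleting no vertex of a copy would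
-- leave a 3-edge-coloured Petersen graph minus an edge, so the resistance is at least 12.
-- For an even factor S, an odd vertex set with no S-edge leaving it contains an odd component.
-- Every copy of P contains one such set, and two disjoint ones if S avoids its terminal
-- edges (the even factors of the Petersen graph have an isolated vertex or are two pentagons).
-- By parity S uses both terminal edges of a 2-pole or neither; if it uses those of H, it uses
-- those of exactly one of the two copies of P, so H contains at least 3 odd components if it is
-- crossed by S and 2 otherwise. Either S crosses exactly two copies of H₂, giving
-- 6 + 6 + 4 = 16, as it must when it is a 2-factor, or it crosses none, giving 4 + 4 + 4 and two
-- more in {u₀} and {u₁, u₂, u₃}.

open import Defs
open import Data.Bool using (Bool; true; false; _∧_; _∨_; _xor_; not; if_then_else_; T)
open import Data.Bool.ListAction using (all; any)
import Data.Bool.Properties as Bool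
open import Data.Bool.Properties using (T-≡; T?; not-¬; ¬-not)
open import Data.Empty using (⊥)
open import Data.Fin using (Fin; toℕ)
import Data.Fin as F
import Data.Fin.Properties as F
open import Data.Fin.Subset using (Subset; _∈_; ∣_∣)
open import Data.Fin.Subset.Properties using (_∈?_)
open import Data.List using (List; []; _∷_; _++_; _∷ʳ_; map; length; lookup; applyUpTo; upTo; allFin; concatMap; replicate)
open import Data.List.Membership.Propositional using (find) renaming (_∈_ to _∈ˡ_)
import Data.List.Membership.Propositional.Properties as Mem
open import Data.List.Properties using (≡-dec; applyUpTo-∷ʳ; length-applyUpTo; length-++)
open import Data.List.Relation.Unary.All as All using (All; []; _∷_)
import Data.List.Relation.Unary.All.Properties as All
open import Data.List.Relation.Unary.AllPairs using ([]; _∷_)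
open import Data.List.Relation.Unary.Any as Any using (Any; here; there)
import Data.List.Relation.Unary.Any.Properties as Any
open import Data.List.Relation.Unary.Unique.Propositional using (Unique)
import Data.List.Relation.Unary.Unique.Propositional.Properties as Unique
open import Data.Nat
open import Data.Nat.Divisibility using (_∣_; divides; _∣?_)
open import Data.Nat.DivMod using (_mod_)
open import Data.Nat.GeneralisedArithmetic using (iterate)
open import Data.Nat.Properties
open import Data.Product using (_×_; _,_; proj₁; proj₂; Σ; ∃; ∃-syntax)
open import Data.Sum using (_⊎_; inj₁; inj₂; [_,_]′)
open import Data.Vec using ([]; _∷_; fromList)
import Data.Vec as Vec
open import Data.Vec.Properties using ([]=⇒lookup)
open import Function using (_∘_; id; case_of_; Equivalence)
open import Relation.Binary.Construct.Closure.ReflexiveTransitive using (ε; _◅_; _◅◅_; reverse)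
open import Relation.Binary.PropositionalEquality
open import Relation.Nullary using (¬_; Dec; yes; no; does; contradiction)
open import Relation.Nullary.Decidable using (map′; from-yes; decidable-stable; ¬?; _×-dec_; _⊎-dec_)
open import Algebra.Properties.CommutativeMonoid.Sum +-0-commutativeMonoid using (sum; ∑-distrib-+)

-- Counting over finite sets.

bit : Bool → ℕ
bit b = if b then 1 else 0

countF-cong : ∀ {n} {p q : Fin n → Bool} → (∀ i → p i ≡ q i) → countF p ≡ countF q
countF-cong {zero}  p≗q = refl
countF-cong {suc n} p≗q = cong₂ (λ a b → bit a + b) (p≗q F.zero) (countF-cong (p≗q ∘ F.suc))

countF-mono : ∀ {n} {p q : Fin n → Bool} → (∀ i → p i ≡ true → q i ≡ true) → countF p ≤ countF q
countF-mono {zero} p⇒q = z≤n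
countF-mono {suc n} {p} {q} p⇒q = +-mono-≤ (bit-mono (p F.zero) (q F.zero) (p⇒q F.zero)) (countF-mono (p⇒q ∘ F.suc))
  where
  bit-mono : ∀ a b → (a ≡ true → b ≡ true) → bit a ≤ bit b
  bit-mono false b     a⇒b = z≤n
  bit-mono true  true  a⇒b = ≤-refl
  bit-mono true  false a⇒b = case a⇒b refl of λ ()

∧-true : ∀ a {b} → a ∧ b ≡ true → a ≡ true × b ≡ true
∧-true true b≡true = refl , b≡true

countF-remove : ∀ {n} (p : Fin n → Bool) l → p l ≡ true →
  suc (countF (λ i → p i ∧ not (does (i F.≟ l)))) ≤ countF p
countF-remove p F.zero pl rewrite pl = s≤s (countF-mono λ i → proj₁ ∘ ∧-true (p (F.suc i)))
countF-remove p (F.suc l) pl with p F.zero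
... | true  = s≤s (countF-remove (p ∘ F.suc) l pl)
... | false = countF-remove (p ∘ F.suc) l pl

length≤countF : ∀ {n} (p : Fin n → Bool) {ls} → Unique ls → All (λ l → p l ≡ true) ls → length ls ≤ countF p
length≤countF p [] [] = z≤n
length≤countF p {l ∷ ls} (l∉ls ∷ uls) (pl ∷ pls) =
  ≤-trans (s≤s (length≤countF _ uls (All.zipWith still (l∉ls , pls)))) (countF-remove p l pl)
  where
  still : ∀ {i} → l ≢ i × p i ≡ true → p i ∧ not (does (i F.≟ l)) ≡ true
  still {i} (l≢i , pi) with i F.≟ l
  ... | yes i≡l = contradiction (sym i≡l) l≢i
  ... | no _ rewrite pi = refl

∣p∣≡countF : ∀ {n} (D : Subset n) → ∣ D ∣ ≡ countF (inS D)
∣p∣≡countF [] = refl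
∣p∣≡countF (true  ∷ D) = cong suc (∣p∣≡countF D)
∣p∣≡countF (false ∷ D) = ∣p∣≡countF D

sumTo : (ℕ → ℕ) → ℕ → ℕ
sumTo f zero    = 0
sumTo f (suc n) = sumTo f n + f n

-- The lists picked for different `q` are disjoint, so their concatenation is duplicate-free and
-- `length≤countF` applies. It serves odd components and deleted vertices alike.
sumTo≤countF : ∀ {N} (p : Fin N → Bool) (P : ℕ → Fin N → Set) →
  (∀ {q r l} → P q l → P r l → q ≡ r) → (∀ {q l} → P q l → p l ≡ true) →
  (f : ℕ → ℕ) (n : ℕ) →
  (∀ q → q < n → ∃[ ls ] (Unique ls × All (P q) ls × length ls ≡ f q)) →
  sumTo f n ≤ countF p
sumTo≤countF {N} p P disjoint P⇒p f n pick =
  let ls , uls , Pls , len = collect n pick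
  in subst (_≤ countF p) len (length≤countF p uls (All.map (λ (_ , _ , Pl) → P⇒p Pl) Pls))
  where
  collect : ∀ n → (∀ q → q < n → ∃[ ls ] (Unique ls × All (P q) ls × length ls ≡ f q)) →
    ∃[ ls ] (Unique ls × All (λ l → ∃[ q ] (q < n × P q l)) ls × length ls ≡ sumTo f n)
  collect zero pick = [] , [] , [] , refl
  collect (suc n) pick =
    let ls , uls , Pls , lenls = collect n (λ q q<n → pick q (m<n⇒m<1+n q<n))
        ks , uks , Pks , lenks = pick n ≤-refl
    in ls ++ ks
     , Unique.++⁺ uls uks (λ (l∈ls , l∈ks) →
         let q , q<n , Pq = All.lookup Pls l∈ls
         in <-irrefl (disjoint Pq (All.lookup Pks l∈ks)) q<n)
     , All.++⁺ (All.map (λ (q , q<n , Pq) → q , m<n⇒m<1+n q<n , Pq) Pls)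
               (All.map (λ Pn → n , ≤-refl , Pn) Pks)
     , trans (length-++ ls) (cong₂ _+_ lenls lenks)

-- Parity of sums and counts.

odd?-suc : ∀ n → odd? (suc n) ≡ not (odd? n)
odd?-suc zero          = refl
odd?-suc (suc zero)    = refl
odd?-suc (suc (suc n)) = odd?-suc n

odd?-+ : ∀ m n → odd? (m + n) ≡ odd? m xor odd? n
odd?-+ zero          n = refl
odd?-+ (suc zero)    n = odd?-suc n
odd?-+ (suc (suc m)) n = odd?-+ m n

2∣⇒¬odd? : ∀ {n} → 2 ∣ n → odd? n ≡ false
2∣⇒¬odd? (divides zero    refl) = refl
2∣⇒¬odd? (divides (suc q) refl) = 2∣⇒¬odd? (divides q refl)

odd?-countF⇒∃ : ∀ {n} (p : Fin n → Bool) → odd? (countF p) ≡ true → ∃[ i ] p i ≡ true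
odd?-countF⇒∃ {suc n} p odd with p F.zero in p0
... | true  = F.zero , p0
... | false = let i , pi = odd?-countF⇒∃ (p ∘ F.suc) odd in F.suc i , pi

odd?-sum⇒∃ : ∀ {n} (f : Fin n → ℕ) → odd? (sum f) ≡ true → ∃[ i ] odd? (f i) ≡ true
odd?-sum⇒∃ {suc n} f odd with odd? (f F.zero) in f0
... | true  = F.zero , f0
... | false =
  let i , fi = odd?-sum⇒∃ (f ∘ F.suc) (trans (sym (trans (odd?-+ (f F.zero) _) (cong (_xor odd? (sum (f ∘ F.suc))) f0))) odd)
  in F.suc i , fi

sum-0 : ∀ n → sum {n} (λ _ → 0) ≡ 0
sum-0 zero    = refl
sum-0 (suc n) = sum-0 n

sum-δ : ∀ {N} (k : Fin N) b → sum (λ (l : Fin N) → bit (b ∧ (toℕ k ≡ᵇ toℕ l))) ≡ bit b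
sum-δ {N} k false = sum-0 N
sum-δ {suc N} F.zero true = cong suc (sum-0 N)
sum-δ (F.suc k) true = sum-δ k true

-- Each `v` satisfying `p` lies in exactly one fibre of `c`. With `odd?-sum⇒∃`, an odd set therefore
-- meets some fibre in an odd number of elements.
countF-fibres : ∀ {n N} (p : Fin n → Bool) (c : Fin n → Fin N) →
  sum (λ (l : Fin N) → countF (λ v → p v ∧ (toℕ (c v) ≡ᵇ toℕ l))) ≡ countF p
countF-fibres {zero}  {N} p c = sum-0 N
countF-fibres {suc n} {N} p c = trans
  (∑-distrib-+ {N} (λ l → bit (p F.zero ∧ (toℕ (c F.zero) ≡ᵇ toℕ l)))
               (λ l → countF (λ v → p (F.suc v) ∧ (toℕ (c (F.suc v)) ≡ᵇ toℕ l))))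
  (cong₂ _+_ (sum-δ (c F.zero) (p F.zero)) (countF-fibres (p ∘ F.suc) (c ∘ F.suc)))

-- Stars and edge sets in terms of edge numbers.

nth : ∀ {A : Set} → A → List A → ℕ → A
nth d []       n       = d
nth d (x ∷ xs) zero    = x
nth d (x ∷ xs) (suc n) = nth d xs n

nth-applyUpTo : ∀ {A : Set} (d : A) f {k n} → n < k → nth d (applyUpTo f k) n ≡ f n
nth-applyUpTo d f {suc k} {zero}  n<k       = refl
nth-applyUpTo d f {suc k} {suc n} (s≤s n<k) = nth-applyUpTo d (f ∘ suc) n<k

-- Stars and cuts become lists of numbers, so that facts about G can be evaluated and P is carried
-- into G by mapping a renumbering over them.
positions : ∀ {A : Set} → (A → Bool) → List A → List ℕ
positions p []       = []
positions p (x ∷ xs) = (if p x then 0 ∷_ else id) (map suc (positions p xs))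

∈-positions : ∀ {A : Set} (p : A → Bool) xs i → p (lookup xs i) ≡ true → toℕ i ∈ˡ positions p xs
∈-positions p (x ∷ xs) F.zero px rewrite px = here refl
∈-positions p (x ∷ xs) (F.suc i) pi with p x
... | true  = there (Mem.∈-map⁺ suc (∈-positions p xs i pi))
... | false = Mem.∈-map⁺ suc (∈-positions p xs i pi)

positions-< : ∀ {A : Set} (p : A → Bool) xs → All (_< length xs) (positions p xs)
positions-< p [] = []
positions-< p (x ∷ xs) with p x
... | true  = s≤s z≤n ∷ All.map⁺ (All.map s≤s (positions-< p xs))
... | false = All.map⁺ (All.map s≤s (positions-< p xs))

tally : (ℕ → Bool) → List ℕ → ℕ
tally f []       = 0
tally f (n ∷ ns) = bit (f n) + tally f ns

tally-map : ∀ f g ns → tally f (map g ns) ≡ tally (f ∘ g) ns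
tally-map f g []       = refl
tally-map f g (n ∷ ns) = cong (bit (f (g n)) +_) (tally-map f g ns)

tally-cong : ∀ {f g ns} → All (λ n → f n ≡ g n) ns → tally f ns ≡ tally g ns
tally-cong []         = refl
tally-cong (fn ∷ fns) = cong₂ (λ a b → bit a + b) fn (tally-cong fns)

countF-positions : ∀ {A : Set} (f : ℕ → Bool) (p : A → Bool) xs →
  countF (λ i → f (toℕ i) ∧ p (lookup xs i)) ≡ tally f (positions p xs)
countF-positions f p [] = refl
countF-positions f p (x ∷ xs)
  with p x | trans (countF-positions (f ∘ suc) p xs) (sym (tally-map f suc (positions p xs)))
... | true  | ih with f 0
...   | true  = cong suc ih
...   | false = ih
countF-positions f p (x ∷ xs) | false | ih with f 0
...   | true  = ih
...   | false = ih

-- Being total on numbers, it composes with `edgeNo q`, which restricts an edge set of G to the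
-- `q`-th copy of P.
χ : ∀ {m} → Subset m → ℕ → Bool
χ []      n       = false
χ (b ∷ S) zero    = b
χ (b ∷ S) (suc n) = χ S n

inS≡χ : ∀ {m} (S : Subset m) e → inS S e ≡ χ S (toℕ e)
inS≡χ (b ∷ S) F.zero    = refl
inS≡χ (b ∷ S) (F.suc e) = inS≡χ S e

at : ℕ → ℕ × ℕ → Bool
at v (a , b) = (v ≡ᵇ a) ∨ (v ≡ᵇ b)

deg≡tally : ∀ Γ S v → deg Γ S v ≡ tally (χ S) (positions (at (toℕ v)) (edges Γ))
deg≡tally Γ S v = trans
  (countF-cong λ e → cong (_∧ incident Γ v e) (inS≡χ S e))
  (countF-positions (χ S) (at (toℕ v)) (edges Γ))

Avoids : (ℕ → Bool) → List ℕ → Set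
Avoids f = All (λ n → f n ≡ false)

avoids-cong : ∀ {f g k ns} → (∀ {n} → n < k → f n ≡ g n) → All (_< k) ns → Avoids f ns → Avoids g ns
avoids-cong f≗g []         []         = []
avoids-cong f≗g (n<k ∷ ns) (fn ∷ fns) = trans (sym (f≗g n<k)) fn ∷ avoids-cong f≗g ns fns

avoids⇒false : ∀ {Γ S} p → Avoids (χ S) (positions p (edges Γ)) → ∀ {e} → e ∈ S → p (ends Γ e) ≡ false
avoids⇒false {Γ} {S} p av {e} e∈S = ¬-not λ pe → contradiction
  (trans (sym ([]=⇒lookup e∈S)) (trans (inS≡χ S e) (All.lookup av (∈-positions p (edges Γ) e pe)))) λ ()

-- Odd closed vertex sets and odd components.

cut : (ℕ → Bool) → ℕ × ℕ → Bool
cut m (a , b) = m a xor m b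

xor-false : ∀ a b → a xor b ≡ false → a ≡ b
xor-false true  true  _ = refl
xor-false false false _ = refl

Closed : (Γ : Graph) → EdgeSet Γ → (ℕ → Bool) → Set
Closed Γ S m = Avoids (χ S) (positions (cut m) (edges Γ))

closed-adj : ∀ {Γ S} m → Closed Γ S m → ∀ {x y} → Adj Γ S x y → m (toℕ x) ≡ m (toℕ y)
closed-adj {Γ} m cl (inj₁ (e , e∈S , eq)) = xor-false _ _ (trans (cong (cut m) (sym eq)) (avoids⇒false {Γ} (cut m) cl e∈S))
closed-adj {Γ} m cl (inj₂ (e , e∈S , eq)) = sym (xor-false _ _ (trans (cong (cut m) (sym eq)) (avoids⇒false {Γ} (cut m) cl e∈S)))

closed-reach : ∀ {Γ S} m → Closed Γ S m → ∀ {x y} → Reach Γ S x y → m (toℕ x) ≡ m (toℕ y)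
closed-reach m cl ε        = refl
closed-reach {Γ} m cl (a ◅ r) = trans (closed-adj {Γ} m cl a) (closed-reach {Γ} m cl r)

record OddClosed (Γ : Graph) (S : EdgeSet Γ) (m : ℕ → Bool) : Set where
  constructor oddClosed
  field
    closed : Closed Γ S m
    odd    : odd? (countF (λ (v : V Γ) → m (toℕ v))) ≡ true

module Components (Γ : Graph) (S : EdgeSet Γ) (k : ℕ) (comps : OddComponents Γ S k) (region : ℕ → ℕ) where

  c : V Γ → V Γ
  c = proj₁ comps

  lab : IsComponentLabelling Γ S c
  lab = proj₁ (proj₂ comps)

  OddLabel : V Γ → Set
  OddLabel l = odd? (countF (λ v → toℕ (c v) ≡ᵇ toℕ l)) ≡ true

  oddLabel-inhabited : ∀ {l} → OddLabel l → ∃[ v ] c v ≡ l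
  oddLabel-inhabited odd =
    let v , cv = odd?-countF⇒∃ _ odd
    in v , F.toℕ-injective (≡ᵇ⇒≡ _ _ (Equivalence.from T-≡ cv))

  -- The label classes inside a closed set partition it, so one of them is odd if the set is.
  odd-closed⇒oddLabel : ∀ m → OddClosed Γ S m →
    ∃[ l ] (OddLabel l × (∀ v → c v ≡ l → m (toℕ v) ≡ true))
  odd-closed⇒oddLabel m (oddClosed cl odd) = l , trans (cong odd? (countF-cong (sym ∘ drop))) odd-l , inside
    where
    fibre = odd?-sum⇒∃ (λ (l : V Γ) → countF (λ v → m (toℕ v) ∧ (toℕ (c v) ≡ᵇ toℕ l))) (trans (cong odd? (countF-fibres (λ (v : V Γ) → m (toℕ v)) c)) odd)
    l = proj₁ fibre
    odd-l = proj₂ fibre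
    member = odd?-countF⇒∃ (λ v → m (toℕ v) ∧ (toℕ (c v) ≡ᵇ toℕ l)) odd-l
    w = proj₁ member
    mw = proj₁ (∧-true _ (proj₂ member))
    cw : c w ≡ l
    cw = F.toℕ-injective (≡ᵇ⇒≡ _ _ (Equivalence.from T-≡ (proj₂ (∧-true (m (toℕ w)) (proj₂ member)))))
    inside : ∀ v → c v ≡ l → m (toℕ v) ≡ true
    inside v cv = trans (closed-reach {Γ} m cl (proj₁ (lab v w) (trans cv (sym cw)))) mw
    drop : ∀ v → m (toℕ v) ∧ (toℕ (c v) ≡ᵇ toℕ l) ≡ (toℕ (c v) ≡ᵇ toℕ l)
    drop v with toℕ (c v) ≡ᵇ toℕ l in eq
    ... | true rewrite inside v (F.toℕ-injective (≡ᵇ⇒≡ _ _ (Equivalence.from T-≡ eq))) = refl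
    ... | false with m (toℕ v)
    ...   | true  = refl
    ...   | false = refl

  OddIn : ℕ → V Γ → Set
  OddIn q l = OddLabel l × (∀ v → c v ≡ l → region (toℕ v) ≡ q)

  oddIn-disjoint : ∀ {q r l} → OddIn q l → OddIn r l → q ≡ r
  oddIn-disjoint (odd , in-q) (_ , in-r) =
    let v , cv = oddLabel-inhabited odd in trans (sym (in-q v cv)) (in-r v cv)

  record Supply (q k : ℕ) : Set where
    constructor supply
    field
      labels : List (V Γ)
      unique : Unique labels
      oddIn  : All (OddIn q) labels
      amount : length labels ≡ k

  supply-one : ∀ {q} m → OddClosed Γ S m → (∀ n → m n ≡ true → region n ≡ q) → Supply q 1
  supply-one m oc m⊆q =
    let l , odd , inside = odd-closed⇒oddLabel m oc
    in supply (l ∷ []) ([] ∷ []) ((odd , λ v cv → m⊆q _ (inside v cv)) ∷ []) refl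

  -- The labels differ because a vertex of the first class lies in `m₁`, and equal labels would put
  -- it into `m₂` as well.
  supply-two : ∀ {q} m₁ m₂ → OddClosed Γ S m₁ → OddClosed Γ S m₂ →
    (∀ n → m₁ n ≡ true → region n ≡ q) → (∀ n → m₂ n ≡ true → region n ≡ q) →
    (∀ n → m₁ n ≡ true → m₂ n ≡ true → ⊥) → Supply q 2
  supply-two m₁ m₂ oc₁ oc₂ m₁⊆q m₂⊆q disjoint =
    let l₁ , odd₁ , inside₁ = odd-closed⇒oddLabel m₁ oc₁
        l₂ , odd₂ , inside₂ = odd-closed⇒oddLabel m₂ oc₂
        v , cv = oddLabel-inhabited odd₁
    in supply (l₁ ∷ l₂ ∷ [])
         (((λ l₁≡l₂ → disjoint _ (inside₁ v cv) (inside₂ v (trans cv l₁≡l₂))) ∷ []) ∷ [] ∷ [])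
         ((odd₁ , λ v cv → m₁⊆q _ (inside₁ v cv)) ∷ (odd₂ , λ v cv → m₂⊆q _ (inside₂ v cv)) ∷ [])
         refl

  supply-sum : ∀ g n → (∀ q → q < n → Supply q (g q)) → sumTo g n ≤ k
  supply-sum g n sup = subst (sumTo g n ≤_) (sym (proj₂ (proj₂ comps)))
    (sumTo≤countF _ OddIn oddIn-disjoint proj₁ g n
      λ q q<n → let supply ls uls ols len = sup q q<n in ls , uls , ols , len)

-- Exhaustive search by backtracking.

T-∧⁻ : ∀ a {b} → T (a ∧ b) → T a × T b
T-∧⁻ true tb = _ , tb

T-∨⁻ : ∀ a {b} → T (a ∨ b) → T a ⊎ T b
T-∨⁻ true  _  = inj₁ _
T-∨⁻ false tb = inj₂ tb

witness : ∀ {A : Set} (a? : Dec A) → T (does a?) → A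
witness (yes a) _ = a

module Backtrack {A : Set} (domain : List A) (complete : ∀ a → a ∈ˡ domain) (dead : List A → Bool) where

  refutes : ℕ → List A → Bool
  refutes zero    as = dead as
  refutes (suc n) as = dead as ∨ all (λ a → refutes n (as ∷ʳ a)) domain

  -- The search tree is followed along the branch of `f`, whose nodes are the prefixes
  -- `applyUpTo f k`; this branch must reach a dead one.
  refutes-sound : ∀ n → T (refutes n []) → (f : ℕ → A) → ∃[ j ] T (dead (applyUpTo f j))
  refutes-sound n r f = go n 0 r
    where
    go : ∀ n k → T (refutes n (applyUpTo f k)) → ∃[ j ] T (dead (applyUpTo f j))
    go zero    k r = k , r
    go (suc n) k r with T-∨⁻ (dead (applyUpTo f k)) r
    ... | inj₁ d  = k , d
    ... | inj₂ rs = go n (suc k)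
      (subst (T ∘ refutes n) (applyUpTo-∷ʳ f k) (All.lookup (All.all⁺ _ domain rs) (complete (f k))))

-- The 2-pole P: edges 14 and 15 are its terminal edges, with terminal vertices 10 and 11

Pedges : List (ℕ × ℕ)
Pedges = inner P ++ (0 , 10) ∷ (1 , 11) ∷ []

starP : ℕ → List ℕ
starP x = positions (at x) Pedges

cutP : (ℕ → Bool) → List ℕ
cutP X = positions (cut X) Pedges

-- Every even factor of the Petersen graph has an isolated vertex or consists of two
-- pentagons; of each complementary pair of pentagons one not containing both 0 and 1 is listed.
candidates : List (ℕ → Bool)
candidates = map (λ X n → any (n ≡ᵇ_) X) (map (_∷ []) (upTo 10) ++
  (5 ∷ 6 ∷ 7 ∷ 8 ∷ 9 ∷ []) ∷ (3 ∷ 4 ∷ 6 ∷ 8 ∷ 9 ∷ []) ∷ (2 ∷ 3 ∷ 5 ∷ 7 ∷ 8 ∷ []) ∷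
  (2 ∷ 3 ∷ 4 ∷ 7 ∷ 9 ∷ []) ∷ (0 ∷ 3 ∷ 4 ∷ 5 ∷ 8 ∷ []) ∷ (0 ∷ 4 ∷ 5 ∷ 7 ∷ 9 ∷ []) ∷ [])

rest : (ℕ → Bool) → ℕ → Bool
rest X n = (n <ᵇ 10) ∧ not (X n)

avoids? : ∀ f ns → Dec (Avoids f ns)
avoids? f = All.all? λ n → f n Bool.≟ false

-- The set `X` yields one odd closed set. If terminal edge 14 is absent, the other vertices of P, 9
-- or 5 in number, have to yield a second one.
Separated : (ℕ → Bool) → (ℕ → Bool) → Set
Separated b X = Avoids b (cutP X) × (b 14 ≡ true ⊎ Avoids b (cutP (rest X)))

separated? : ∀ b X → Dec (Separated b X)
separated? b X = avoids? b (cutP X) ×-dec (b 14 Bool.≟ true ⊎-dec avoids? b (cutP (rest X)))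

OddSplit : (ℕ → Bool) → Set
OddSplit b = b 14 ≡ b 15 × Any (Separated b) candidates

oddSplit? : ∀ b → Dec (OddSplit b)
oddSplit? b = b 14 Bool.≟ b 15 ×-dec Any.any? (separated? b) candidates

oddSplit-cong : ∀ {a b} → (∀ {n} → n < 16 → a n ≡ b n) → OddSplit a → OddSplit b
oddSplit-cong {a} {b} a≗b (ends , splits) =
  trans (sym (a≗b (from-yes (14 <? 16)))) (trans ends (a≗b (from-yes (15 <? 16)))) , Any.map (λ {X} → separated X) splits
  where
  avoids : ∀ X → Avoids a (cutP X) → Avoids b (cutP X)
  avoids X = avoids-cong {ns = cutP X} a≗b (positions-< (cut X) Pedges)
  separated : ∀ X → Separated a X → Separated b X
  separated X (av , inj₁ s)  = avoids X av , inj₁ (trans (sym (a≗b (from-yes (14 <? 16)))) s)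
  separated X (av , inj₂ av₂) = avoids X av , inj₂ (avoids (rest X) av₂)

module EvenSearch where

  -- Keeps the default of `nth` from standing in for an edge without a value.
  known : List Bool → List ℕ → Bool
  known bs ns = all (_<ᵇ length bs) ns

  oddOn : List Bool → List ℕ → Bool
  oddOn bs ns = known bs ns ∧ odd? (tally (nth false bs) ns)

  finished : List Bool → Bool
  finished bs = (length bs ≡ᵇ 16) ∧ does (oddSplit? (nth false bs))

  -- A full assignment satisfying `OddSplit` counts as dead too, so a successful refutation says
  -- that every assignment has a vertex of odd degree or satisfies `OddSplit`.
  dead : List (List ℕ) → List Bool → Bool
  dead stars bs = any (oddOn bs) stars ∨ finished bs

  complete : ∀ a → a ∈ˡ (true ∷ false ∷ [])
  complete true  = here refl
  complete false = there (here refl)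

  open Backtrack (true ∷ false ∷ []) complete (dead (map starP (upTo 10)))

  exhaust : ∀ b → ∃[ j ] T (dead (map starP (upTo 10)) (applyUpTo b j))
  -- The underscore is filled by evaluating the whole search; 16 is the number of edges of P
  -- including the terminal edges.
  exhaust = refutes-sound 16 _

  oddSplit : ∀ b → (∀ {x} → x < 10 → odd? (tally b (starP x)) ≡ false) → OddSplit b
  oddSplit b even = let j , d = exhaust b in conclude j d
    where
    conclude : ∀ j → T (dead (map starP (upTo 10)) (applyUpTo b j)) → OddSplit b
    conclude j d = case T-∨⁻ (any (oddOn bs) (map starP (upTo 10))) d of λ where
        (inj₁ o) → let ns , ns∈ , odd = find (Any.any⁻ (oddOn bs) (map starP (upTo 10)) o)
                       x , x∈ , ns≡ = Mem.∈-map⁻ starP ns∈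
                   in contradiction (trans (sym (cong (odd? ∘ tally b) ns≡)) (odd-on ns odd))
                                    (not-¬ (even (Mem.∈-upTo⁻ x∈)))
        (inj₂ f) → let len , good = T-∧⁻ (length bs ≡ᵇ 16) f in
                   oddSplit-cong (agree (trans (sym (length-applyUpTo b j)) (≡ᵇ⇒≡ _ _ len)))
                                 (witness (oddSplit? (nth false bs)) good)
      where
      bs = applyUpTo b j
      agree : j ≡ 16 → ∀ {n} → n < 16 → nth false bs n ≡ b n
      agree j≡16 n<16 = nth-applyUpTo false b (subst (_ <_) (sym j≡16) n<16)
      odd-on : ∀ ns → T (oddOn bs ns) → odd? (tally b ns) ≡ true
      odd-on ns odd = trans (cong odd? (sym (tally-cong (All.map (nth-applyUpTo false b) defined))))
                          (Equivalence.to T-≡ (proj₂ split))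
        where
        split = T-∧⁻ (known bs ns) odd
        defined : All (_< j) ns
        defined = All.map (λ n< → subst (_ <_) (length-applyUpTo b j) (<ᵇ⇒< _ _ n<))
                          (All.all⁺ _ ns (proj₁ split))

pairs : ∀ {A : Set} → List A → List (A × A)
pairs []       = []
pairs (x ∷ xs) = map (x ,_) xs ++ pairs xs

-- Only inner edges occur: the Petersen graph minus an edge already has no proper 3-edge-colouring,
-- and these edges have both ends inside the copy.
conflicts : List (ℕ × ℕ × ℕ)
conflicts = concatMap (λ x → map (x ,_) (pairs (positions (at x) (inner P)))) (upTo 10)

module ColourSearch where

  clash : List (Fin 3) → ℕ × ℕ × ℕ → Bool
  clash cs (x , i , j) = ((i <ᵇ length cs) ∧ (j <ᵇ length cs)) ∧ does (nth F.zero cs i F.≟ nth F.zero cs j)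

  dead : List (ℕ × ℕ × ℕ) → List (Fin 3) → Bool
  dead ts cs = any (clash cs) ts

  open Backtrack (allFin 3) Mem.∈-allFin (dead conflicts)

  exhaust : ∀ f → ∃[ j ] T (dead conflicts (applyUpTo f j))
  exhaust = refutes-sound 14 _

  P-uncolourable : (f : ℕ → Fin 3) → Any (λ (x , i , j) → f i ≡ f j) conflicts
  P-uncolourable f = let j , d = exhaust f in conclude j d
    where
    unclash : ∀ k {t} → T (clash (applyUpTo f k) t) → f (proj₁ (proj₂ t)) ≡ f (proj₂ (proj₂ t))
    unclash k {x , i , j} t =
      trans (sym (nth-applyUpTo F.zero f (bound (proj₁ bounds))))
            (trans (witness (nth F.zero cs i F.≟ nth F.zero cs j) (proj₂ parts))
                   (nth-applyUpTo F.zero f (bound (proj₂ bounds))))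
      where
      cs = applyUpTo f k
      parts = T-∧⁻ ((i <ᵇ length cs) ∧ (j <ᵇ length cs)) t
      bounds = T-∧⁻ (i <ᵇ length cs) (proj₁ parts)
      bound : ∀ {n} → T (n <ᵇ length cs) → n < k
      bound n< = subst (_ <_) (length-applyUpTo f k) (<ᵇ⇒< _ _ n<)
    conclude : ∀ k → T (dead conflicts (applyUpTo f k)) → Any (λ (x , i , j) → f i ≡ f j) conflicts
    conclude k d = Any.map (λ {t} → unclash k {t}) (Any.any⁻ (clash (applyUpTo f k)) conflicts d)

-- The twelve copies of P in G

-- Region q < 12 is the vertex set of the q-th copy of P; 12 is {u₀}, 13 is {u₁, u₂, u₃},
-- and 14 collects the attachment vertices 20 and 21 of the copies of H.
region : ℕ → ℕ
region n = if n <ᵇ 4 then (if n ≡ᵇ 0 then 12 else 13)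
  else (if (n ∸ 4) % 22 <ᵇ 20 then 2 * ((n ∸ 4) / 22) + (n ∸ 4) % 22 / 10 else 14)

local : ℕ → ℕ
local n = (n ∸ 4) % 22 % 10

vertexNo : ℕ → ℕ → ℕ
vertexNo q x = 4 + 22 * (q / 2) + 10 * (q % 2) + x

-- The triangle takes 3 edges, each copy of `H₂` with its two attaching edges 67, and each copy of
-- `H` 32: 14 for each copy of P, then the four edges from these to the attachment vertices.
edgeNo : ℕ → ℕ → ℕ
edgeNo q i = 3 + 67 * (q / 4) + 32 * (q / 2 % 2) +
  (if i <ᵇ 14 then 14 * (q % 2) + i else 28 + 2 * (i ∸ 14) + q % 2)

embed : ℕ → (ℕ → Bool) → ℕ → Bool
embed q X n = (region n ≡ᵇ q) ∧ X (local n)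

embed⊆region : ∀ q X n → embed q X n ≡ true → region n ≡ q
embed⊆region q X n e = ≡ᵇ⇒≡ _ _ (Equivalence.from T-≡ (proj₁ (∧-true (region n ≡ᵇ q) e)))

embed-disjoint : ∀ q X n → embed q X n ≡ true → embed q (rest X) n ≡ true → ⊥
embed-disjoint q X n e₁ e₂ =
  let inX = proj₂ (∧-true (region n ≡ᵇ q) e₁)
      inR = proj₂ (∧-true (local n <ᵇ 10) (proj₂ (∧-true (region n ≡ᵇ q) e₂)))
  in contradiction (trans (sym inR) (cong not inX)) λ ()

starG : ℕ → List ℕ
starG n = positions (at n) (edges G)

cutG : (ℕ → Bool) → List ℕ
cutG m = positions (cut m) (edges G)

-- The terminal edges of the h-th copy of H: outer 0 h at its vertex 20, outer 1 h at its vertex 21.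
outer : ℕ → ℕ → ℕ
outer zero    h = (if h % 2 ≡ᵇ 0 then 68 else 67) + 67 * (h / 2)
outer (suc _) h = (if h % 2 ≡ᵇ 0 then 67 else 69) + 67 * (h / 2)

hubStar : ℕ → ℕ → List ℕ
hubStar t h = edgeNo (2 * h) (14 + t) ∷ edgeNo (1 + 2 * h) (14 + t) ∷ outer t h ∷ []

_≟ˡ_ : (ms ns : List ℕ) → Dec (ms ≡ ns)
_≟ˡ_ = ≡-dec _≟_

-- The part of `OddClosed` that does not mention the factor, hence open to evaluation; only `Avoids`
-- on `ns` is left to prove.
record OddCut (m : ℕ → Bool) (ns : List ℕ) : Set where
  constructor oddCut
  field
    cut≡ : cutG m ≡ ns
    odd  : odd? (countF (λ (v : V G) → m (toℕ v))) ≡ true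

oddCut? : ∀ m ns → Dec (OddCut m ns)
oddCut? m ns = map′ (λ (cut≡ , odd) → oddCut cut≡ odd) (λ (oddCut cut≡ odd) → cut≡ , odd)
  (cutG m ≟ˡ ns ×-dec odd? (countF (λ (v : V G) → m (toℕ v))) Bool.≟ true)

oddCut⇒oddClosed : ∀ S {m ns} → OddCut m ns → Avoids (χ S) ns → OddClosed G S m
oddCut⇒oddClosed S (oddCut cut≡ odd) av = oddClosed (subst (Avoids (χ S)) (sym cut≡) av) odd

abstract

  -- Evaluated for all 120 vertices. It turns even degrees in G into the hypothesis of
  -- `EvenSearch.oddSplit` for each copy of P.
  starG-embed : ∀ {q} → q < 12 → ∀ {x} → x < 10 →
    vertexNo q x < 136 × starG (vertexNo q x) ≡ map (edgeNo q) (starP x)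
  starG-embed = from-yes (allUpTo? (λ q → allUpTo? (λ x →
    vertexNo q x <? 136 ×-dec starG (vertexNo q x) ≟ˡ map (edgeNo q) (starP x)) 10) 12)

  oddCut-embed : ∀ {q} → q < 12 → All (λ X →
    OddCut (embed q X) (map (edgeNo q) (cutP X)) ×
    OddCut (embed q (rest X)) (map (edgeNo q) (cutP (rest X)))) candidates
  oddCut-embed = from-yes (allUpTo? (λ q → All.all? (λ X →
    oddCut? (embed q X) (map (edgeNo q) (cutP X)) ×-dec
    oddCut? (embed q (rest X)) (map (edgeNo q) (cutP (rest X)))) candidates) 12)

  starG-hub : ∀ {t} → t < 2 → ∀ {h} → h < 6 → 24 + t + 22 * h < 136 × starG (24 + t + 22 * h) ≡ hubStar t h
  starG-hub = from-yes (allUpTo? (λ t → allUpTo? (λ h →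
    24 + t + 22 * h <? 136 ×-dec starG (24 + t + 22 * h) ≟ˡ hubStar t h) 6) 2)

  star-u₀ : starG 0 ≡ 68 ∷ 135 ∷ 202 ∷ []
  star-u₀ = refl

  oddCut-u₀ : OddCut (λ n → region n ≡ᵇ 12) (68 ∷ 135 ∷ 202 ∷ [])
  oddCut-u₀ = oddCut refl refl

  oddCut-triangle : OddCut (λ n → region n ≡ᵇ 13) (69 ∷ 136 ∷ 203 ∷ [])
  oddCut-triangle = oddCut refl refl

-- Lower bounds for even factors and 2-factors.

even-star : ∀ S → EvenFactor G S → ∀ {n} → n < 136 → odd? (tally (χ S) (starG n)) ≡ false
even-star S even {n} n<136 = subst (λ k → odd? (tally (χ S) (starG k)) ≡ false) (F.toℕ-fromℕ< n<136)
  (trans (cong odd? (sym (deg≡tally G S v))) (2∣⇒¬odd? (even v)))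
  where v = F.fromℕ< n<136

even-triple : ∀ (f : ℕ → Bool) a b c → odd? (tally f (a ∷ b ∷ c ∷ [])) ≡ false → f c ≡ f a xor f b
even-triple f a b c even with f a | f b | f c
... | true  | true  | false = refl
... | true  | false | true  = refl
... | false | true  | true  = refl
... | false | false | false = refl

-- The number of odd components guaranteed inside a copy of P, according to whether its
-- terminal edges lie in the factor.
copies : Bool → ℕ
copies σ = if σ then 1 else 2

-- The same for a copy of H.
through : Bool → ℕ
through τ = if τ then 3 else 2

-- Equality except when the terminal edges of both copies of P are avoided, where 4 exceeds 2. The
-- `xor` is parity at an attachment vertex.
through≤copies : ∀ σ₁ σ₂ → through (σ₁ xor σ₂) ≤ copies σ₁ + copies σ₂
through≤copies true  true  = ≤-refl
through≤copies true  false = ≤-refl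
through≤copies false true  = ≤-refl
through≤copies false false = s≤s (s≤s z≤n)

sumTo-pairs : ∀ (f g : ℕ → ℕ) n → (∀ {h} → h < n → g h ≤ f (2 * h) + f (1 + 2 * h)) → sumTo g n ≤ sumTo f (2 * n)
sumTo-pairs f g zero g≤f = z≤n
sumTo-pairs f g (suc n) g≤f = begin
  sumTo g n + g n                                     ≤⟨ +-mono-≤ (sumTo-pairs f g n (λ h<n → g≤f (m<n⇒m<1+n h<n))) (g≤f ≤-refl) ⟩
  sumTo f (2 * n) + (f (2 * n) + f (1 + 2 * n))       ≡⟨ +-assoc (sumTo f (2 * n)) _ _ ⟨
  sumTo f (2 * n) + f (2 * n) + f (1 + 2 * n)         ≡⟨ cong (sumTo f) (*-suc 2 n) ⟨
  sumTo f (2 * suc n)                                 ∎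
  where open ≤-Reasoning

-- With the test `q <ᵇ 12`, the sum of the extended amounts over 14 regions unfolds to the sum over
-- the twelve copies plus 1 plus 1.
extend-by-two : ∀ (R : ℕ → ℕ → Set) (a : ℕ → ℕ) → (∀ q → q < 12 → R q (a q)) → R 12 1 → R 13 1 →
  ∀ q → q < 14 → R q (if q <ᵇ 12 then a q else 1)
extend-by-two R a low R₁₂ R₁₃ q q<14 with q <ᵇ 12 in eq
... | true = low q (<ᵇ⇒< q 12 (Equivalence.from T-≡ eq))
... | false with m≤n⇒m<n∨m≡n (≮⇒≥ {q} {12} λ q<12 → subst T eq (<⇒<ᵇ q<12))
...   | inj₂ refl = R₁₂
...   | inj₁ 12<q with ≤-antisym 12<q (s≤s⁻¹ q<14)
...     | refl = R₁₃

module EvenFactors {S : EdgeSet G} (even : EvenFactor G S) where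

  f : ℕ → Bool
  f = χ S

  σ : ℕ → Bool
  σ q = f (edgeNo q 14)

  split : ∀ {q} → q < 12 → OddSplit (f ∘ edgeNo q)
  split {q} q<12 = EvenSearch.oddSplit (f ∘ edgeNo q) λ {x} x<10 →
    let v<136 , star = starG-embed q<12 x<10
    in trans (cong odd? (trans (sym (tally-map f (edgeNo q) (starP x))) (cong (tally f) (sym star))))
             (even-star S even v<136)

  hub : ∀ {t h} → t < 2 → h < 6 → f (outer t h) ≡ f (edgeNo (2 * h) (14 + t)) xor f (edgeNo (1 + 2 * h) (14 + t))
  hub {t} {h} t<2 h<6 =
    let v<136 , star = starG-hub t<2 h<6
    in even-triple f _ _ _ (trans (cong (odd? ∘ tally f) (sym star)) (even-star S even v<136))

  outer₀ : ∀ {h} → h < 6 → f (outer 0 h) ≡ σ (2 * h) xor σ (1 + 2 * h)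
  outer₀ h<6 = hub (s≤s z≤n) h<6

  -- Parity at vertex 21, together with the agreement of the two terminal edges of each copy of P
  -- given by `split`.
  outer₁ : ∀ {h} → h < 6 → f (outer 1 h) ≡ σ (2 * h) xor σ (1 + 2 * h)
  outer₁ {h} h<6 = trans (hub (s≤s (s≤s z≤n)) h<6)
    (cong₂ _xor_ (sym (proj₁ (split 2h<12))) (sym (proj₁ (split 1+2h<12))))
    where
    1+2h<12 : 1 + 2 * h < 12
    1+2h<12 = subst (_≤ 12) (*-distribˡ-+ 2 1 h) (*-monoʳ-≤ 2 h<6)
    2h<12 : 2 * h < 12
    2h<12 = <-trans (n<1+n _) 1+2h<12

  -- Edge 68 + 67i joins u₀ to copy i of `H₂`, counted from 0.
  τ : ℕ → Bool
  τ i = f (68 + 67 * i)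

  -- For even `h` the edge in question is `outer 0 h`. For odd `h` the edge joining the two copies
  -- of `H` is both `outer 1` of the preceding copy and `outer 0 h`, which carries the value across.
  linked-copies : ∀ {h} → h < 6 → τ (h / 2) ≡ σ (2 * h) xor σ (1 + 2 * h)
  linked-copies {0} h<6 = outer₀ h<6
  linked-copies {1} h<6 = trans (outer₀ {0} z<s) (trans (sym (outer₁ {0} z<s)) (outer₀ h<6))
  linked-copies {2} h<6 = outer₀ h<6
  linked-copies {3} h<6 = trans (outer₀ {2} 2<6) (trans (sym (outer₁ {2} 2<6)) (outer₀ h<6))
    where 2<6 = from-yes (2 <? 6)
  linked-copies {4} h<6 = outer₀ h<6
  linked-copies {5} h<6 = trans (outer₀ {4} 4<6) (trans (sym (outer₁ {4} 4<6)) (outer₀ h<6))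
    where 4<6 = from-yes (4 <? 6)
  linked-copies {suc (suc (suc (suc (suc (suc h)))))} h<6 = contradiction h<6 (m+n≮m 6 h)

  far-end : ∀ {i} → i < 3 → f (69 + 67 * i) ≡ τ i
  far-end {0} _ = trans (outer₁ {1} 1<6) (sym (linked-copies 1<6))
    where 1<6 = from-yes (1 <? 6)
  far-end {1} _ = trans (outer₁ {3} 3<6) (sym (linked-copies 3<6))
    where 3<6 = from-yes (3 <? 6)
  far-end {2} _ = trans (outer₁ {5} 5<6) (sym (linked-copies 5<6))
    where 5<6 = from-yes (5 <? 6)
  far-end {suc (suc (suc i))} i<3 = contradiction i<3 (m+n≮m 3 i)

  copies-sum : sumTo (λ h → through (τ (h / 2))) 6 ≤ sumTo (copies ∘ σ) 12
  copies-sum = sumTo-pairs (copies ∘ σ) (λ h → through (τ (h / 2))) 6 λ {h} h<6 →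
    subst (λ t → through t ≤ copies (σ (2 * h)) + copies (σ (1 + 2 * h)))
          (sym (linked-copies h<6)) (through≤copies (σ (2 * h)) (σ (1 + 2 * h)))

  centre : τ 2 ≡ τ 0 xor τ 1
  centre = even-triple f 68 135 202 (trans (cong (odd? ∘ tally f) (sym star-u₀)) (even-star S even {0} z<s))

  module Bounds (k : ℕ) (comps : OddComponents G S k) where

    open Components G S k comps region using (Supply; supply-one; supply-two; supply-sum)

    supply-copy : ∀ {q} → q < 12 → Supply q (copies (σ q))
    supply-copy {q} q<12 = from-split (find (proj₂ (split q<12)))
      where
      from-split : (∃[ X ] (X ∈ˡ candidates × Separated (f ∘ edgeNo q) X)) → Supply q (copies (σ q))
      from-split (X , X∈ , av , rest-av) = amount (σ q) rest-av
        where
        cuts = All.lookup (oddCut-embed q<12) X∈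
        oc₁ : OddClosed G S (embed q X)
        oc₁ = oddCut⇒oddClosed S (proj₁ cuts) (All.map⁺ av)
        amount : ∀ s → s ≡ true ⊎ Avoids (f ∘ edgeNo q) (cutP (rest X)) → Supply q (copies s)
        amount true _ = supply-one (embed q X) oc₁ (embed⊆region q X)
        amount false (inj₂ av₂) = supply-two (embed q X) (embed q (rest X))
          oc₁ (oddCut⇒oddClosed S (proj₂ cuts) (All.map⁺ av₂))
          (embed⊆region q X) (embed⊆region q (rest X)) (embed-disjoint q X)

    supply-region : ∀ q → OddClosed G S (λ n → region n ≡ᵇ q) → Supply q 1
    supply-region q oc = supply-one (λ n → region n ≡ᵇ q) oc (λ n e → ≡ᵇ⇒≡ _ _ (Equivalence.from T-≡ e))

    16≤⊎inactive : 16 ≤ k ⊎ (τ 0 ≡ false × τ 1 ≡ false × τ 2 ≡ false)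
    16≤⊎inactive = cases (τ 0) (τ 1) (τ 2) centre
      (≤-trans copies-sum (supply-sum (copies ∘ σ) 12 (λ _ → supply-copy)))
      where
      cases : ∀ a b d → d ≡ a xor b →
        -- This is the left side of `copies-sum` unfolded; with `h / 2` evaluated, each copy of `H₂`
        -- occurs twice.
        0 + through a + through a + through b + through b + through d + through d ≤ k →
        16 ≤ k ⊎ (a ≡ false × b ≡ false × d ≡ false)
      cases true  true  _ refl bound = inj₁ bound
      cases true  false _ refl bound = inj₁ bound
      cases false true  _ refl bound = inj₁ bound
      cases false false _ refl bound = inj₂ (refl , refl , refl)

    inactive⇒14≤ : τ 0 ≡ false × τ 1 ≡ false × τ 2 ≡ false → 14 ≤ k
    inactive⇒14≤ (τ₀ , τ₁ , τ₂) = ≤-trans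
      (+-monoˡ-≤ 1 (+-monoˡ-≤ 1 (≤-trans 12≤ copies-sum)))
      (supply-sum g 14 sup)
      where
      g : ℕ → ℕ
      g q = if q <ᵇ 12 then copies (σ q) else 1
      12≤ : 12 ≤ sumTo (λ h → through (τ (h / 2))) 6
      12≤ = bound (τ 0) (τ 1) (τ 2) τ₀ τ₁ τ₂
        where
        bound : ∀ a b d → a ≡ false → b ≡ false → d ≡ false →
          12 ≤ 0 + through a + through a + through b + through b + through d + through d
        bound _ _ _ refl refl refl = ≤-refl
      sup : ∀ q → q < 14 → Supply q (g q)
      sup = extend-by-two Supply (copies ∘ σ) (λ _ → supply-copy)
        (supply-region 12 (oddCut⇒oddClosed S oddCut-u₀ (τ₀ ∷ τ₁ ∷ τ₂ ∷ [])))
        (supply-region 13 (oddCut⇒oddClosed S oddCut-triangle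
          (trans (far-end {0} z<s) τ₀ ∷ trans (far-end {1} (s<s z<s)) τ₁ ∷ trans (far-end {2} ≤-refl) τ₂ ∷ [])))

weak-lower : ∀ S k → EvenFactor G S → OddComponents G S k → 14 ≤ k
weak-lower S k even comps = [ ≤-trans (from-yes (14 ≤? 16)) , inactive⇒14≤ ]′ 16≤⊎inactive
  where open EvenFactors.Bounds {S} even k comps

TwoFactor⇒EvenFactor : ∀ {Γ} S → TwoFactor Γ S → EvenFactor Γ S
TwoFactor⇒EvenFactor S two v = divides 1 (two v)

tally-avoids : ∀ {f ns} → Avoids f ns → tally f ns ≡ 0
tally-avoids []         = refl
tally-avoids (fn ∷ fns) rewrite fn = tally-avoids fns

oddness-lower : ∀ S k → TwoFactor G S → OddComponents G S k → 16 ≤ k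
oddness-lower S k two comps = [ id , (λ (τ₀ , τ₁ , τ₂) → contradiction (covered τ₀ τ₁ τ₂) λ ()) ]′ 16≤⊎inactive
  where
  even : EvenFactor G S
  even = TwoFactor⇒EvenFactor {G} S two
  open EvenFactors {S} even using (τ)
  open EvenFactors.Bounds {S} even k comps
  -- If all three edges at u₀ are avoided, its degree is 0, whereas a 2-factor has degree 2 there.
  covered : τ 0 ≡ false → τ 1 ≡ false → τ 2 ≡ false → 2 ≡ 0
  covered τ₀ τ₁ τ₂ = trans (sym (two F.zero)) (trans (deg≡tally G S F.zero)
    (trans (cong (tally (χ S)) star-u₀) (tally-avoids {χ S} {68 ∷ 135 ∷ 202 ∷ []} (τ₀ ∷ τ₁ ∷ τ₂ ∷ []))))

-- Lower bound for the resistance.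

edge : ℕ → E G
edge n = n mod 204

-- As in `edge`, the residue replaces a bound proof: G has 136 vertices and 204 edges.
vertex : ℕ → V G
vertex n = n mod 136

record Within (q : ℕ) (e : E G) : Set where
  constructor within
  field
    first  : region (proj₁ (ends G e)) ≡ q
    second : region (proj₂ (ends G e)) ≡ q

within? : ∀ q e → Dec (Within q e)
within? q e = map′ (λ (a , b) → within a b) (λ (within a b) → a , b)
  (region (proj₁ (ends G e)) ≟ q ×-dec region (proj₂ (ends G e)) ≟ q)

record Meeting (q : ℕ) (v : V G) (e f : E G) : Set where
  constructor meeting
  field
    distinct : e ≢ f
    at-e     : incident G v e ≡ true
    at-f     : incident G v f ≡ true
    in-e     : Within q e
    in-f     : Within q f

meeting? : ∀ q v e f → Dec (Meeting q v e f)
meeting? q v e f = map′ (λ (a , b , c , d , g) → meeting a b c d g) (λ (meeting a b c d g) → a , b , c , d , g)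
  (¬? (e F.≟ f) ×-dec incident G v e Bool.≟ true ×-dec incident G v f Bool.≟ true ×-dec within? q e ×-dec within? q f)

abstract

  conflicts-embed : ∀ {q} → q < 12 → All (λ (x , i , j) →
    Meeting q (vertex (vertexNo q x)) (edge (edgeNo q i)) (edge (edgeNo q j))) conflicts
  conflicts-embed = from-yes (allUpTo? (λ q → All.all? (λ (x , i , j) →
    meeting? q (vertex (vertexNo q x)) (edge (edgeNo q i)) (edge (edgeNo q j))) conflicts) 12)

Hits : Subset 136 → ℕ → V G → Set
Hits D q v = v ∈ D × region (toℕ v) ≡ q

survives-unhit : ∀ {D q e} → Within q e → ¬ ∃ (Hits D q) → Survives G D e
survives-unhit {D} {q} {e} (within a b) unhit v inc v∈D = unhit (v , v∈D ,
  [ (λ t → trans (cong region (≡ᵇ⇒≡ (toℕ v) (proj₁ (ends G e)) t)) a) , (λ t → trans (cong region (≡ᵇ⇒≡ (toℕ v) (proj₂ (ends G e)) t)) b) ]′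
    (T-∨⁻ (toℕ v ≡ᵇ proj₁ (ends G e)) (Equivalence.from T-≡ inc)))

meeting⇒≢ : ∀ D (colouring : Colourable-Minus G D) {q} → ¬ ∃ (Hits D q) →
  ∀ v e f → Meeting q v e f → proj₁ colouring e ≢ proj₁ colouring f
meeting⇒≢ D (col , proper) unhit v e f (meeting distinct at-e at-f in-e in-f) =
  proper e f distinct (survives-unhit in-e unhit) (survives-unhit in-f unhit) (v , at-e , at-f)

-- If no vertex of the copy were deleted, all its inner edges would survive, and the colouring of
-- these would contradict `P-uncolourable`.
copy-hit : ∀ D → Colourable-Minus G D → ∀ {q} → q < 12 → ∃ (Hits D q)
copy-hit D colouring {q} q<12 =
  decidable-stable (F.any? λ v → v ∈? D ×-dec region (toℕ v) ≟ q) λ unhit →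
    let (x , i , j) , t∈ , same = find (ColourSearch.P-uncolourable (λ i → proj₁ colouring (edge (edgeNo q i))))
    in meeting⇒≢ D colouring unhit (vertex (vertexNo q x)) (edge (edgeNo q i)) (edge (edgeNo q j))
         (All.lookup (conflicts-embed q<12) t∈) same

resistance-lower : ∀ D → Colourable-Minus G D → 12 ≤ ∣ D ∣
resistance-lower D colourable = subst (12 ≤_) (sym (∣p∣≡countF D))
  (sumTo≤countF (inS D) (Hits D) (λ (_ , q≡) (_ , r≡) → trans (sym q≡) r≡) (λ (v∈D , _) → []=⇒lookup v∈D)
    (λ _ → 1) 12 λ q q<12 → let v , hits = copy-hit D colourable q<12 in v ∷ [] , [] ∷ [] , hits ∷ [] , refl)

-- In each copy of P the vertex 5 is deleted. The colours below, with 0 and 1 on the terminal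
-- edges, are proper at all other vertices; the second copy of P in H swaps 0 and 1, so that
-- both terminal edges of H get colour 2, and the three copies of H₂ are rotated.
coloursP : List ℕ
coloursP = 0 ∷ 1 ∷ 0 ∷ 1 ∷ 2 ∷ 2 ∷ 2 ∷ 2 ∷ 2 ∷ 0 ∷ 1 ∷ 0 ∷ 1 ∷ 0 ∷ []

-- Modulo 3, `4 ∸_` swaps 0 and 1 and fixes 2. The last four entries belong to the terminal edges of
-- the two copies of P.
coloursH : List ℕ
coloursH = coloursP ++ map (4 ∸_) coloursP ++ 0 ∷ 1 ∷ 1 ∷ 0 ∷ []

coloursG : List ℕ
coloursG = 2 ∷ 1 ∷ 0 ∷ concatMap (λ i → map (_+ i) (coloursH ++ coloursH ++ 2 ∷ 2 ∷ 2 ∷ [])) (1 ∷ 2 ∷ 3 ∷ [])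

colourNo : ℕ → Fin 3
colourNo n = nth 0 coloursG n mod 3

deleted : Subset 136
deleted = Vec.tabulate λ v → (region (toℕ v) <ᵇ 12) ∧ (local (toℕ v) ≡ᵇ 5)

abstract

  ∣deleted∣≡12 : ∣ deleted ∣ ≡ 12
  ∣deleted∣≡12 = refl

  proper-at : ∀ v → v ∈ deleted ⊎ All (λ i → All (λ j → i ≡ j ⊎ colourNo i ≢ colourNo j) (starG (toℕ v))) (starG (toℕ v))
  proper-at = from-yes (F.all? λ v → v ∈? deleted ⊎-dec
    All.all? (λ i → All.all? (λ j → i ≟ j ⊎-dec ¬? (colourNo i F.≟ colourNo j)) (starG (toℕ v))) (starG (toℕ v)))

resistance-upper : Colourable-Minus G deleted
resistance-upper = colourNo ∘ toℕ , λ e f e≢f surv-e surv-f (v , at-e , at-f) →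
  [ (λ v∈ → contradiction v∈ (surv-e v at-e))
  , (λ ps → [ (λ i≡j → contradiction (F.toℕ-injective i≡j) e≢f) , id ]′
              (All.lookup (All.lookup ps (∈-positions (at (toℕ v)) (edges G) e at-e))
                          (∈-positions (at (toℕ v)) (edges G) f at-f))) ]′
  (proper-at v)

-- Component labellings certified by forests.

linked : ∀ (es : List (ℕ × ℕ)) → Subset (length es) → ℕ → ℕ → Bool
linked []             []      a b = false
linked ((x , y) ∷ es) (s ∷ S) a b = (s ∧ (((x ≡ᵇ a) ∧ (y ≡ᵇ b)) ∨ ((x ≡ᵇ b) ∧ (y ≡ᵇ a)))) ∨ linked es S a b

linked-sound : ∀ (es : List (ℕ × ℕ)) S a b → T (linked es S a b) →
  (Σ (Fin (length es)) λ e → e ∈ S × lookup es e ≡ (a , b)) ⊎ (Σ (Fin (length es)) λ e → e ∈ S × lookup es e ≡ (b , a))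
linked-sound [] [] a b ()
linked-sound ((x , y) ∷ es) (s ∷ S) a b l
  with T-∨⁻ (s ∧ (((x ≡ᵇ a) ∧ (y ≡ᵇ b)) ∨ ((x ≡ᵇ b) ∧ (y ≡ᵇ a)))) l
... | inj₂ later with linked-sound es S a b later
...   | inj₁ (e , e∈S , eq) = inj₁ (F.suc e , Vec.there e∈S , eq)
...   | inj₂ (e , e∈S , eq) = inj₂ (F.suc e , Vec.there e∈S , eq)
linked-sound ((x , y) ∷ es) (true ∷ S) a b l | inj₁ now with T-∨⁻ ((x ≡ᵇ a) ∧ (y ≡ᵇ b)) now
... | inj₁ xy = let p , q = T-∧⁻ (x ≡ᵇ a) xy in inj₁ (F.zero , Vec.here , cong₂ _,_ (≡ᵇ⇒≡ x a p) (≡ᵇ⇒≡ y b q))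
... | inj₂ yx = let p , q = T-∧⁻ (x ≡ᵇ b) yx in inj₂ (F.zero , Vec.here , cong₂ _,_ (≡ᵇ⇒≡ x b p) (≡ᵇ⇒≡ y a q))

differ : (ℕ → ℕ) → ℕ × ℕ → Bool
differ label (a , b) = not (label a ≡ᵇ label b)

-- A component labelling is certified by a forest of parent pointers: each vertex reaches its
-- label in N steps along S, and the label is constant on the edges of S.
module Forest (Γ : Graph) (S : EdgeSet Γ) (parent c : V Γ → V Γ) (up label : ℕ → ℕ) (N : ℕ)
  (parent≡ : ∀ v → toℕ (parent v) ≡ up (toℕ v))
  (c≡      : ∀ v → toℕ (c v) ≡ label (toℕ v))
  (step    : ∀ (v : V Γ) → up (toℕ v) ≡ toℕ v ⊎ T (linked (edges Γ) S (toℕ v) (up (toℕ v))))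
  (climb   : ∀ (v : V Γ) → iterate up (toℕ v) N ≡ label (toℕ v))
  (steady  : Avoids (χ S) (positions (differ label) (edges Γ))) where

  adj-sym : ∀ {x y} → Adj Γ S x y → Adj Γ S y x
  adj-sym (inj₁ a) = inj₂ a
  adj-sym (inj₂ a) = inj₁ a

  reach-parent : ∀ v → Reach Γ S v (parent v)
  reach-parent v with step v
  ... | inj₁ root = subst (Reach Γ S v) (F.toℕ-injective (sym (trans (parent≡ v) root))) ε
  ... | inj₂ l    = linked-sound (edges Γ) S (toℕ v) (toℕ (parent v))
    (subst (λ n → T (linked (edges Γ) S (toℕ v) n)) (sym (parent≡ v)) l) ◅ ε

  reach-iterate : ∀ n v → Reach Γ S v (iterate parent v n)
  reach-iterate zero    v = ε
  reach-iterate (suc n) v = reach-parent v ◅◅ reach-iterate n (parent v)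

  iterate-parent : ∀ n v → toℕ (iterate parent v n) ≡ iterate up (toℕ v) n
  iterate-parent zero    v = refl
  iterate-parent (suc n) v = trans (iterate-parent n (parent v)) (cong (λ a → iterate up a n) (parent≡ v))

  reach-c : ∀ v → Reach Γ S v (c v)
  reach-c v = subst (Reach Γ S v)
    (F.toℕ-injective (trans (iterate-parent N v) (trans (climb v) (sym (c≡ v)))))
    (reach-iterate N v)

  label-edge : ∀ {e} → e ∈ S → ∀ {a b} → ends Γ e ≡ (a , b) → label a ≡ label b
  label-edge {e} e∈S {a} {b} eq with avoids⇒false {Γ} _ steady e∈S
  ... | same rewrite eq with label a ≡ᵇ label b in t
  ...   | true = ≡ᵇ⇒≡ _ _ (Equivalence.from T-≡ t)

  c-adj : ∀ {x y} → Adj Γ S x y → c x ≡ c y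
  c-adj {x} {y} a = F.toℕ-injective (trans (c≡ x) (trans
    ([ (λ (e , e∈S , eq) → label-edge e∈S eq) , (λ (e , e∈S , eq) → sym (label-edge e∈S eq)) ]′ a) (sym (c≡ y))))

  c-reach : ∀ {x y} → Reach Γ S x y → c x ≡ c y
  c-reach ε       = refl
  c-reach (a ◅ r) = trans (c-adj a) (c-reach r)

  labelling : IsComponentLabelling Γ S c
  labelling x y =
      -- Both vertices climb to the common label, and the second climb is reversed.
      (λ cx≡cy → reach-c x ◅◅ subst (λ z → Reach Γ S z y) (sym cx≡cy) (reverse adj-sym (reach-c y)))
    , c-reach

-- Two even factors of P: the path 0 4 3 2 1 with the pentagon 5 7 9 6 8, and the two
-- pentagons 0 4 3 8 5 and 1 2 7 9 6.
pathP pentagonsP : List Bool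
pathP      = true ∷ true ∷ true ∷ true ∷ false ∷ false ∷ false ∷ false ∷ false ∷ true ∷ true ∷ true ∷ true ∷ true ∷ []
pentagonsP = true ∷ false ∷ true ∷ true ∷ true ∷ true ∷ true ∷ true ∷ false ∷ false ∷ true ∷ true ∷ false ∷ true ∷ []

-- In `crossedH` a path joins vertices 20 and 21 through the first copy of P and three pentagons
-- remain. In `closedH` two paths form a circuit of length 12 through 20 and 21, leaving two
-- pentagons.
crossedH closedH : List Bool
crossedH = pathP ++ pentagonsP ++ true ∷ false ∷ true ∷ false ∷ []
closedH  = pathP ++ pathP ++ true ∷ true ∷ true ∷ true ∷ []

crossedH₂ closedH₂ : List Bool
crossedH₂ = crossedH ++ crossedH ++ true ∷ true ∷ true ∷ []
closedH₂  = closedH ++ closedH ++ false ∷ false ∷ false ∷ []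

-- Parents and labels of vertices, starting at vertex o; r is the parent of the end 0 of the
-- path (or the attachment vertex 20), respectively the label of the component of the path.
parents-pathP : ℕ → ℕ → List ℕ
parents-pathP o r = r ∷ map (o +_) (2 ∷ 3 ∷ 4 ∷ 0 ∷ 5 ∷ 9 ∷ 5 ∷ 5 ∷ 7 ∷ [])

parents-crossedH parents-closedH : ℕ → ℕ → List ℕ
parents-crossedH o r = parents-pathP o (o + 20) ++
  map (10 + o +_) (0 ∷ 1 ∷ 1 ∷ 4 ∷ 0 ∷ 0 ∷ 1 ∷ 2 ∷ 3 ∷ 7 ∷ []) ++ r ∷ o + 1 ∷ []
parents-closedH o r = parents-pathP o (o + 20) ++ parents-pathP (10 + o) (o + 20) ++ r ∷ o + 1 ∷ []

labels-pathP : ℕ → ℕ → List ℕ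
labels-pathP o r = replicate 5 r ++ replicate 5 (o + 5)

labels-crossedH labels-closedH : ℕ → ℕ → List ℕ
labels-crossedH o r = labels-pathP o r ++
  map (10 + o +_) (0 ∷ 1 ∷ 1 ∷ 0 ∷ 0 ∷ 0 ∷ 1 ∷ 1 ∷ 0 ∷ 1 ∷ []) ++ r ∷ r ∷ []
labels-closedH o r = labels-pathP o r ++ labels-pathP (10 + o) r ++ r ∷ r ∷ []

parents-crossedH₂ parents-closedH₂ labels-crossedH₂ labels-closedH₂ : ℕ → List ℕ
parents-crossedH₂ o = parents-crossedH o 0 ++ parents-crossedH (22 + o) (o + 21)
parents-closedH₂ o  = parents-closedH o (o + 20) ++ parents-closedH (22 + o) (22 + o + 20)
labels-crossedH₂ o  = labels-crossedH o 0 ++ labels-crossedH (22 + o) 0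
labels-closedH₂ o   = labels-closedH o (o + 20) ++ labels-closedH (22 + o) (22 + o + 20)

module _ (S : EdgeSet G) (parents labels : List ℕ) (k : ℕ) where

  up label : ℕ → ℕ
  up    = nth 0 parents
  label = nth 0 labels

  parent c : V G → V G
  parent = vertex ∘ up ∘ toℕ
  c      = vertex ∘ label ∘ toℕ

  -- No path to a root is longer than 20.
  record Certificate : Set where
    constructor certificate
    field
      parent≡ : ∀ v → toℕ (parent v) ≡ up (toℕ v)
      c≡      : ∀ v → toℕ (c v) ≡ label (toℕ v)
      step    : ∀ (v : V G) → up (toℕ v) ≡ toℕ v ⊎ T (linked (edges G) S (toℕ v) (up (toℕ v)))
      climb   : ∀ (v : V G) → iterate up (toℕ v) 20 ≡ label (toℕ v)
      steady  : Avoids (χ S) (positions (differ label) (edges G))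
      count   : countF (λ (l : V G) → odd? (countF (λ (v : V G) → label (toℕ v) ≡ᵇ toℕ l))) ≡ k

  certificate? : Dec Certificate
  certificate? = map′
    (λ (p , c , s , i , a , o) → certificate p c s i a o)
    (λ (certificate p c s i a o) → p , c , s , i , a , o)
    (F.all? (λ v → toℕ (parent v) ≟ up (toℕ v)) ×-dec
     F.all? (λ v → toℕ (c v) ≟ label (toℕ v)) ×-dec
     F.all? (λ (v : V G) → up (toℕ v) ≟ toℕ v ⊎-dec T? (linked (edges G) S (toℕ v) (up (toℕ v)))) ×-dec
     F.all? (λ (v : V G) → iterate up (toℕ v) 20 ≟ label (toℕ v)) ×-dec
     avoids? (χ S) (positions (differ label) (edges G)) ×-dec
     countF (λ (l : V G) → odd? (countF (λ (v : V G) → label (toℕ v) ≡ᵇ toℕ l))) ≟ k)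

  oddComponents : Certificate → OddComponents G S k
  oddComponents (certificate parent≡ c≡ step climb steady count) = c
    , Forest.labelling G S parent c up label 20 parent≡ c≡ step climb steady
    , trans (sym count) (countF-cong λ (l : V G) → cong odd? (countF-cong λ v → cong (_≡ᵇ toℕ l) (sym (c≡ v))))

-- `S-weak` isolates u₀ and keeps the triangle. In `S-two` an even circuit of length 32 runs from u₀
-- through the first copy of `H₂`, then u₁, u₃, u₂, and back through the second copy.
S-weak S-two : EdgeSet G
S-weak = fromList (true ∷ true ∷ true ∷ closedH₂ ++ closedH₂ ++ closedH₂)
S-two  = fromList (false ∷ true ∷ true ∷ crossedH₂ ++ crossedH₂ ++ closedH₂)

parents-weak labels-weak parents-two labels-two : List ℕ
parents-weak = 0 ∷ 1 ∷ 1 ∷ 1 ∷ parents-closedH₂ 4 ++ parents-closedH₂ 48 ++ parents-closedH₂ 92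
labels-weak  = 0 ∷ 1 ∷ 1 ∷ 1 ∷ labels-closedH₂ 4 ++ labels-closedH₂ 48 ++ labels-closedH₂ 92
-- The vertices 47 and 91 are the last ones of the first two copies of `H₂`, through which u₁ and u₂
-- climb to the root u₀.
parents-two  = 0 ∷ 47 ∷ 91 ∷ 1 ∷ parents-crossedH₂ 4 ++ parents-crossedH₂ 48 ++ parents-closedH₂ 92
labels-two   = 0 ∷ 0 ∷ 0 ∷ 0 ∷ labels-crossedH₂ 4 ++ labels-crossedH₂ 48 ++ labels-closedH₂ 92

abstract

  tally-weak : ∀ (v : V G) → 2 ∣ tally (χ S-weak) (starG (toℕ v))
  tally-weak = from-yes (F.all? λ (v : V G) → 2 ∣? tally (χ S-weak) (starG (toℕ v)))

  certificate-weak : Certificate S-weak parents-weak labels-weak 14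
  certificate-weak = from-yes (certificate? S-weak parents-weak labels-weak 14)

  tally-two : ∀ (v : V G) → tally (χ S-two) (starG (toℕ v)) ≡ 2
  tally-two = from-yes (F.all? λ (v : V G) → tally (χ S-two) (starG (toℕ v)) ≟ 2)

  certificate-two : Certificate S-two parents-two labels-two 16
  certificate-two = from-yes (certificate? S-two parents-two labels-two 16)

weak-upper : ∃[ S ] (EvenFactor G S × OddComponents G S 14)
weak-upper = S-weak
  , (λ v → subst (2 ∣_) (sym (deg≡tally G S-weak v)) (tally-weak v))
  , oddComponents S-weak parents-weak labels-weak 14 certificate-weak

oddness-upper : ∃[ S ] (TwoFactor G S × OddComponents G S 16)
oddness-upper = S-two
  , (λ v → trans (deg≡tally G S-two v) (tally-two v))
  , oddComponents S-two parents-two labels-two 16 certificate-two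

theorem3 : Resistance G 12 × WeakOddness G 14 × Oddness G 16
theorem3 =
    ((deleted , ∣deleted∣≡12 , resistance-upper) , resistance-lower)
  , (weak-upper , weak-lower)
  , (oddness-upper , oddness-lower)
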